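{- Let $\Phi$ be a tight derivation in system $\mathcal E$ of $\Gamma\vdash^{(b,e,s)}t:\sigma$. Then there exists a term $p\in\mathsf{no}_{\mathtt{wcf}}$ such that $t\twoheadrightarrow_{\mathtt w}^{(b,e)}p$ (i.e. $t$ $\to_{\mathtt w}$-reduces to $p$ with exactly $b$ multiplicative steps and $e$ exponential steps) and $|p|_{\mathtt w}=s$.
   Context: Terms of the $\lambda!$-calculus: $t,u ::= x \mid t\,u \mid \lambda x.t \mid {!t} \mid \mathrm{der}\,t \mid t[x\backslash u]$, where $[x\backslash u]$ is a syntactic explicit substitution; $\lambda x.t$ and $t[x\backslash u]$ bind $x$ in $t$; terms are modulo $\alpha$-conversion. $t\{x\backslash u\}$ is capture-avoiding meta-level substitution. List contexts: $L ::= \Box \mid L[x\backslash t]$. Weak contexts: $W ::= \Box \mid W\,t \mid t\,W \mid \lambda x.W \mid \mathrm{der}\,W \mid W[x\backslash u] \mid t[x\backslash W]$. Rules (avoiding capture): $\mathtt{dB}$: $L\langle\lambda x.t\rangle\,u \mapsto L\langle t[x\backslash u]\rangle$; $\mathtt{s!}$: $t[x\backslash L\langle !u\rangle] \mapsto L\langle t\{x\backslash u\}\rangle$; $\mathtt{d!}$: $\mathrm{der}(L\langle !t\rangle)\mapsto L\langle t\rangle$. $\to_{\mathtt w}$ is the closure of the three rules under weak contexts. $\mathtt{dB}$-steps are multiplicative; $\mathtt{s!}$- and $\mathtt{d!}$-steps are exponential. Weakly clash-free normal terms: $\mathsf{ne}_{\mathtt{wcf}} ::= x \mid \mathsf{ne}_{\mathtt{wcf}}\,\mathsf{na}_{\mathtt{wcf}}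 \mid \mathrm{der}(\mathsf{ne}_{\mathtt{wcf}}) \mid \mathsf{ne}_{\mathtt{wcf}}[x\backslash\mathsf{ne}_{\mathtt{wcf}}]$; $\mathsf{na}_{\mathtt{wcf}} ::= {!t} \mid \mathsf{ne}_{\mathtt{wcf}} \mid \mathsf{na}_{\mathtt{wcf}}[x\backslash\mathsf{ne}_{\mathtt{wcf}}]$ ($t$ any term); $\mathsf{nb}_{\mathtt{wcf}} ::= \mathsf{ne}_{\mathtt{wcf}} \mid \lambda x.\mathsf{no}_{\mathtt{wcf}} \mid \mathsf{nb}_{\mathtt{wcf}}[x\backslash\mathsf{ne}_{\mathtt{wcf}}]$; $\mathsf{no}_{\mathtt{wcf}} ::= \mathsf{na}_{\mathtt{wcf}}\mid\mathsf{nb}_{\mathtt{wcf}}$. Size: $|x|_{\mathtt w}=0$, $|!t|_{\mathtt w}=0$, $|t\,u|_{\mathtt w}=1+|t|_{\mathtt w}+|u|_{\mathtt w}$, $|\lambda x.t|_{\mathtt w}=1+|t|_{\mathtt w}$, $|\mathrm{der}\,t|_{\mathtt w}=1+|t|_{\mathtt w}$, $|t[x\backslash u]|_{\mathtt w}=|t|_{\mathtt w}+|u|_{\mathtt w}$. System $\mathcal E$. Tight constants: $\mathtt{tt} ::= \mathtt a\mid\mathtt b\mid\mathtt n$. Types: $\sigma,\tau ::= \mathtt{tt}\mid M\mid M\to\sigma$; multiset types $M ::= [\sigma_i]_{i\in I}$, $I$ finite, possibly empty. $\overline{\mathtt a}$ stands for any tight constant different from $\mathtt a$ (i.e. $\mathtt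 b$ or $\mathtt n$). Typing contexts map variables to multiset types, all but finitely many to the empty multiset $[\,]$; $+$ is pointwise multiset union; $\Gamma\setminus\!\!\setminus x$ maps $x$ to $[\,]$ and agrees with $\Gamma$ elsewhere. $M$ is tight, written $\mathsf{tight}(M)$, if all its elements are tight constants; $\Gamma$ is tight if all $\Gamma(x)$ are tight; a derivation of $\Gamma\vdash^{(b,e,s)}t:\sigma$ is tight if $\Gamma$ is tight and $\sigma$ is a tight constant. Counters $b,e,s$ are natural numbers. Persistent rules: $(\mathrm{ae}_p)$ from $\Gamma\vdash^{(b,e,s)}t:\mathtt n$ and $\Delta\vdash^{(b',e',s')}u:\overline{\mathtt a}$ infer $\Gamma+\Delta\vdash^{(b+b',e+e',s+s'+1)}t\,u:\mathtt n$; $(\mathrm{ai}_p)$ from $\Gamma\vdash^{(b,e,s)}t:\mathtt{tt}$ (any tight constant) and $\mathsf{tight}(\Gamma(x))$ infer $\Gamma\setminus\!\!\setminus x\vdash^{(b,e,s+1)}\lambda x.t:\mathtt a$; $(\mathrm{bg}_p)$ $\vdash^{(0,0,0)}{!t}:\mathtt b$ (empty context, any $t$); $(\mathrm{dr}_p)$ from $\Gamma\vdash^{(b,e,s)}t:\mathtt n$ infer $\Gamma\vdash^{(b,e,s+1)}\mathrm{der}\,t:\mathtt n$; $(\mathrm{es}_p)$ from $\Gamma\vdash^{(b,e,s)}t:\tau$, $\Delta\vdash^{(b',e',s')}u:\mathtt n$ and $\mathsf{tight}(\Gamma(x))$ infer $(\Gamma\setminus\!\!\setminus x)+\Delta\vdash^{(b+b',e+e',s+s')}t[x\backslash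 u]:\tau$. Consuming rules: $(\mathrm{ax}_c)$ $x:[\sigma]\vdash^{(0,0,0)}x:\sigma$; $(\mathrm{ae}_{c1})$ from $\Gamma\vdash^{(b,e,s)}t:M\to\tau$ and $\Delta\vdash^{(b',e',s')}u:M$ infer $\Gamma+\Delta\vdash^{(b+b'+1,e+e',s+s')}t\,u:\tau$; $(\mathrm{ae}_{c2})$ from $\Gamma\vdash^{(b,e,s)}t:M\to\tau$, $\Delta\vdash^{(b',e',s')}u:\mathtt n$ and $\mathsf{tight}(M)$ infer $\Gamma+\Delta\vdash^{(b+b'+1,e+e',s+s')}t\,u:\tau$; $(\mathrm{ai}_c)$ from $\Gamma\vdash^{(b,e,s)}t:\tau$ infer $\Gamma\setminus\!\!\setminus x\vdash^{(b,e,s)}\lambda x.t:\Gamma(x)\to\tau$; $(\mathrm{bg}_c)$ from $(\Gamma_i\vdash^{(b_i,e_i,s_i)}t:\sigma_i)_{i\in I}$ infer $+_{i\in I}\Gamma_i\vdash^{(\sum_i b_i,\,1+\sum_i e_i,\,\sum_i s_i)}{!t}:[\sigma_i]_{i\in I}$ ($I$ finite, possibly empty); $(\mathrm{dr}_c)$ from $\Gamma\vdash^{(b,e,s)}t:[\sigma]$ infer $\Gamma\vdash^{(b,e,s)}\mathrm{der}\,t:\sigma$; $(\mathrm{es}_c)$ from $\Gamma\vdash^{(b,e,s)}t:\sigma$ and $\Delta\vdash^{(b',e',s')}u:\Gamma(x)$ infer $(\Gamma\setminus\!\!\setminus x)+\Delta\vdash^{(b+b',e+e',s+s')}t[x\backslash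 u]:\sigma$. -}

module Defs where

open import Data.Fin using (Fin; zero; suc)
open import Data.List using (List; []; _∷_; _++_)
open import Data.List.Relation.Unary.All using (All)
open import Data.List.Relation.Binary.Permutation.Homogeneous using (Permutation)
open import Data.Nat using (ℕ; zero; suc; _+_)
open import Data.Product using (_×_)
open import Data.Vec using (Vec; []; _∷_; replicate; zipWith; _[_]≔_)
import Data.Vec.Relation.Unary.All as Vec
open import Data.Vec.Relation.Binary.Pointwise.Inductive using (Pointwise)
open import Function using (_∘_; id)
open import Relation.Binary.PropositionalEquality using (_≢_)

private
  variable
    n m k : ℕ

------------------------------------------------------------------------
-- Terms

infixl 7 _·_
infixl 8 _[_]
infixr 6 ƛ_
infix  9 !_

-- Well-scoped de Bruijn terms: Term n is the set of α-classes of terms with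
-- free variables among n given ones.  In t [ u ], which is t[x\u], index
-- zero of t is the bound variable x.
data Term (n : ℕ) : Set where
  var  : Fin n → Term n
  _·_  : Term n → Term n → Term n
  ƛ_   : Term (suc n) → Term n
  !_   : Term n → Term n
  der  : Term n → Term n
  _[_] : Term (suc n) → Term n → Term n

liftᴿ : (Fin n → Fin m) → Fin (suc n) → Fin (suc m)
liftᴿ ρ zero    = zero
liftᴿ ρ (suc i) = suc (ρ i)

rename : (Fin n → Fin m) → Term n → Term m
rename ρ (var i)   = var (ρ i)
rename ρ (t · u)   = rename ρ t · rename ρ u
rename ρ (ƛ t)     = ƛ rename (liftᴿ ρ) t
rename ρ (! t)     = ! rename ρ t
rename ρ (der t)   = der (rename ρ t)
rename ρ (t [ u ]) = rename (liftᴿ ρ) t [ rename ρ u ]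

liftˢ : (Fin n → Term m) → Fin (suc n) → Term (suc m)
liftˢ θ zero    = var zero
liftˢ θ (suc i) = rename suc (θ i)

subst : (Fin n → Term m) → Term n → Term m
subst θ (var i)   = θ i
subst θ (t · u)   = subst θ t · subst θ u
subst θ (ƛ t)     = ƛ subst (liftˢ θ) t
subst θ (! t)     = ! subst θ t
subst θ (der t)   = der (subst θ t)
subst θ (t [ u ]) = subst (liftˢ θ) t [ subst θ u ]

infixl 8 _⟪_⟫

single : Term n → Fin (suc n) → Term n
single u zero    = u
single u (suc i) = var i

-- t{x\u}, where x is index zero of t.
_⟪_⟫ : Term (suc n) → Term n → Term n
t ⟪ u ⟫ = subst (single u) t

------------------------------------------------------------------------
-- Contexts

-- In LCtx n m and WCtx n m, the whole context lives in scope n and its hole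
-- in scope m; plugging captures the variables bound on the way to the hole.
data LCtx (n : ℕ) : ℕ → Set where
  □    : LCtx n n
  _[_] : LCtx (suc n) m → Term n → LCtx n m

infix 8 _⟨_⟩ᴸ _⟨_⟩ᵂ

_⟨_⟩ᴸ : LCtx n m → Term m → Term n
□         ⟨ t ⟩ᴸ = t
(L [ u ]) ⟨ t ⟩ᴸ = (L ⟨ t ⟩ᴸ) [ u ]

-- The inclusion of the outer scope of L into the scope of its hole.
-- Renaming along it moves a term under the binders of L without capture.
under : LCtx n m → Fin n → Fin m
under □         = id
under (L [ u ]) = under L ∘ suc

data WCtx (n : ℕ) : ℕ → Set where
  □     : WCtx n n
  _·ˡ_  : WCtx n m → Term n → WCtx n m
  _·ʳ_  : Term n → WCtx n m → WCtx n m
  ƛ_    : WCtx (suc n) m → WCtx n m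
  der   : WCtx n m → WCtx n m
  _[_]ˡ : WCtx (suc n) m → Term n → WCtx n m
  _[_]ʳ : Term (suc n) → WCtx n m → WCtx n m

_⟨_⟩ᵂ : WCtx n m → Term m → Term n
□          ⟨ t ⟩ᵂ = t
(W ·ˡ u)   ⟨ t ⟩ᵂ = W ⟨ t ⟩ᵂ · u
(u ·ʳ W)   ⟨ t ⟩ᵂ = u · W ⟨ t ⟩ᵂ
(ƛ W)      ⟨ t ⟩ᵂ = ƛ W ⟨ t ⟩ᵂ
der W      ⟨ t ⟩ᵂ = der (W ⟨ t ⟩ᵂ)
(W [ u ]ˡ) ⟨ t ⟩ᵂ = (W ⟨ t ⟩ᵂ) [ u ]
(u [ W ]ʳ) ⟨ t ⟩ᵂ = u [ W ⟨ t ⟩ᵂ ]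

------------------------------------------------------------------------
-- Weak reduction

data Kind : Set where
  multiplicative exponential : Kind

infix 4 _↦⟨_⟩_ _→w⟨_⟩_ _↠w⟨_⨟_⟩_

data _↦⟨_⟩_ {n : ℕ} : Term n → Kind → Term n → Set where
  dB : (L : LCtx n m) (t : Term (suc m)) (u : Term n) →
       L ⟨ ƛ t ⟩ᴸ · u ↦⟨ multiplicative ⟩ L ⟨ t [ rename (under L) u ] ⟩ᴸ
  s! : (t : Term (suc n)) (L : LCtx n m) (u : Term m) →
       t [ L ⟨ ! u ⟩ᴸ ] ↦⟨ exponential ⟩
       L ⟨ rename (liftᴿ (under L)) t ⟪ u ⟫ ⟩ᴸ
  d! : (L : LCtx n m) (t : Term m) →
       der (L ⟨ ! t ⟩ᴸ) ↦⟨ exponential ⟩ L ⟨ t ⟩ᴸ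

data _→w⟨_⟩_ {n : ℕ} : Term n → Kind → Term n → Set where
  weak : ∀ {κ} (W : WCtx n m) {t u : Term m} →
         t ↦⟨ κ ⟩ u → W ⟨ t ⟩ᵂ →w⟨ κ ⟩ W ⟨ u ⟩ᵂ

-- t ↠w⟨ b ⨟ e ⟩ p: a reduction with b multiplicative and e exponential
-- steps, in any order.
data _↠w⟨_⨟_⟩_ {n : ℕ} : Term n → ℕ → ℕ → Term n → Set where
  done   : ∀ {t} → t ↠w⟨ 0 ⨟ 0 ⟩ t
  m-step : ∀ {t u p b e} → t →w⟨ multiplicative ⟩ u →
           u ↠w⟨ b ⨟ e ⟩ p → t ↠w⟨ suc b ⨟ e ⟩ p
  e-step : ∀ {t u p b e} → t →w⟨ exponential ⟩ u →
           u ↠w⟨ b ⨟ e ⟩ p → t ↠w⟨ b ⨟ suc e ⟩ p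

------------------------------------------------------------------------
-- Weakly clash-free normal terms and weak size

mutual
  data Ne-wcf {n : ℕ} : Term n → Set where
    var  : ∀ i → Ne-wcf (var i)
    _·_  : ∀ {t u} → Ne-wcf t → Na-wcf u → Ne-wcf (t · u)
    der  : ∀ {t} → Ne-wcf t → Ne-wcf (der t)
    _[_] : ∀ {t u} → Ne-wcf t → Ne-wcf u → Ne-wcf (t [ u ])

  data Na-wcf {n : ℕ} : Term n → Set where
    !_   : ∀ t → Na-wcf (! t)
    ne   : ∀ {t} → Ne-wcf t → Na-wcf t
    _[_] : ∀ {t u} → Na-wcf t → Ne-wcf u → Na-wcf (t [ u ])

  data Nb-wcf {n : ℕ} : Term n → Set where
    ne   : ∀ {t} → Ne-wcf t → Nb-wcf t
    ƛ_   : ∀ {t} → No-wcf t → Nb-wcf (ƛ t)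
    _[_] : ∀ {t u} → Nb-wcf t → Ne-wcf u → Nb-wcf (t [ u ])

  data No-wcf {n : ℕ} : Term n → Set where
    na : ∀ {t} → Na-wcf t → No-wcf t
    nb : ∀ {t} → Nb-wcf t → No-wcf t

∣_∣w : Term n → ℕ
∣ var i ∣w   = 0
∣ t · u ∣w   = 1 + ∣ t ∣w + ∣ u ∣w
∣ ƛ t ∣w     = 1 + ∣ t ∣w
∣ ! t ∣w     = 0
∣ der t ∣w   = 1 + ∣ t ∣w
∣ t [ u ] ∣w = ∣ t ∣w + ∣ u ∣w

------------------------------------------------------------------------
-- Types of system ℰ

data TightConst : Set where
  𝕒 𝕓 𝕟 : TightConst

infixr 6 _⇒_
infix  4 _≈_ _≋_ _≋ᶜ_

-- A multiset of types is represented by a list; equality of multisets is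
-- _≋_ below, i.e. permutation at every nesting depth.
mutual
  data Type : Set where
    tt   : TightConst → Type
    mset : Multi → Type
    _⇒_  : Multi → Type → Type

  Multi : Set
  Multi = List Type

mutual
  data _≈_ : Type → Type → Set where
    tt   : ∀ c → tt c ≈ tt c
    mset : ∀ {M N} → M ≋ N → mset M ≈ mset N
    _⇒_  : ∀ {M N σ τ} → M ≋ N → σ ≈ τ → M ⇒ σ ≈ N ⇒ τ

  _≋_ : Multi → Multi → Set
  _≋_ = Permutation _≈_

data IsTight : Type → Set where
  tt : ∀ c → IsTight (tt c)

TightM : Multi → Set
TightM = All IsTight

-- Typing contexts on n variables.  The entry of a bound variable is the head
-- of the vector, so a premise context M ∷ Γ below has M as Γ(x) and Γ as
-- Γ∖∖x.
Ctx : ℕ → Set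
Ctx n = Vec Multi n

∅ : Ctx n
∅ {n} = replicate n []

_∶[_] : Fin n → Type → Ctx n
i ∶[ σ ] = ∅ [ i ]≔ (σ ∷ [])

infixl 6 _⊎_

_⊎_ : Ctx n → Ctx n → Ctx n
_⊎_ = zipWith _++_

_≋ᶜ_ : Ctx n → Ctx n → Set
_≋ᶜ_ = Pointwise _≋_

TightCtx : Ctx n → Set
TightCtx = Vec.All TightM

------------------------------------------------------------------------
-- Typing

infix 4 _⊢⟨_⨟_⨟_⟩_∶_ _⊢*⟨_⨟_⨟_⟩_∶_

mutual
  data _⊢⟨_⨟_⨟_⟩_∶_ {n : ℕ} : Ctx n → ℕ → ℕ → ℕ → Term n → Type → Set where

    ae-p : ∀ {Γ Δ b e s b′ e′ s′ t u ā} →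
           Γ ⊢⟨ b ⨟ e ⨟ s ⟩ t ∶ tt 𝕟 →
           Δ ⊢⟨ b′ ⨟ e′ ⨟ s′ ⟩ u ∶ tt ā → ā ≢ 𝕒 →
           Γ ⊎ Δ ⊢⟨ b + b′ ⨟ e + e′ ⨟ s + s′ + 1 ⟩ t · u ∶ tt 𝕟

    ai-p : ∀ {M Γ b e s t c} →
           M ∷ Γ ⊢⟨ b ⨟ e ⨟ s ⟩ t ∶ tt c → TightM M →
           Γ ⊢⟨ b ⨟ e ⨟ s + 1 ⟩ ƛ t ∶ tt 𝕒

    bg-p : ∀ {t} → ∅ ⊢⟨ 0 ⨟ 0 ⨟ 0 ⟩ ! t ∶ tt 𝕓

    dr-p : ∀ {Γ b e s t} →
           Γ ⊢⟨ b ⨟ e ⨟ s ⟩ t ∶ tt 𝕟 →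
           Γ ⊢⟨ b ⨟ e ⨟ s + 1 ⟩ der t ∶ tt 𝕟

    es-p : ∀ {M Γ Δ b e s b′ e′ s′ t u τ} →
           M ∷ Γ ⊢⟨ b ⨟ e ⨟ s ⟩ t ∶ τ →
           Δ ⊢⟨ b′ ⨟ e′ ⨟ s′ ⟩ u ∶ tt 𝕟 → TightM M →
           Γ ⊎ Δ ⊢⟨ b + b′ ⨟ e + e′ ⨟ s + s′ ⟩ t [ u ] ∶ τ

    ax-c : ∀ {i σ} → i ∶[ σ ] ⊢⟨ 0 ⨟ 0 ⨟ 0 ⟩ var i ∶ σ

    ae-c₁ : ∀ {M Γ Δ b e s b′ e′ s′ t u τ} →
            Γ ⊢⟨ b ⨟ e ⨟ s ⟩ t ∶ M ⇒ τ →
            Δ ⊢⟨ b′ ⨟ e′ ⨟ s′ ⟩ u ∶ mset M →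
            Γ ⊎ Δ ⊢⟨ b + b′ + 1 ⨟ e + e′ ⨟ s + s′ ⟩ t · u ∶ τ

    ae-c₂ : ∀ {M Γ Δ b e s b′ e′ s′ t u τ} →
            Γ ⊢⟨ b ⨟ e ⨟ s ⟩ t ∶ M ⇒ τ →
            Δ ⊢⟨ b′ ⨟ e′ ⨟ s′ ⟩ u ∶ tt 𝕟 → TightM M →
            Γ ⊎ Δ ⊢⟨ b + b′ + 1 ⨟ e + e′ ⨟ s + s′ ⟩ t · u ∶ τ

    ai-c : ∀ {M Γ b e s t τ} →
           M ∷ Γ ⊢⟨ b ⨟ e ⨟ s ⟩ t ∶ τ →
           Γ ⊢⟨ b ⨟ e ⨟ s ⟩ ƛ t ∶ M ⇒ τ

    bg-c : ∀ {Γ b e s t M} →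
           Γ ⊢*⟨ b ⨟ e ⨟ s ⟩ t ∶ M →
           Γ ⊢⟨ b ⨟ 1 + e ⨟ s ⟩ ! t ∶ mset M

    dr-c : ∀ {Γ b e s t σ} →
           Γ ⊢⟨ b ⨟ e ⨟ s ⟩ t ∶ mset (σ ∷ []) →
           Γ ⊢⟨ b ⨟ e ⨟ s ⟩ der t ∶ σ

    es-c : ∀ {M Γ Δ b e s b′ e′ s′ t u σ} →
           M ∷ Γ ⊢⟨ b ⨟ e ⨟ s ⟩ t ∶ σ →
           Δ ⊢⟨ b′ ⨟ e′ ⨟ s′ ⟩ u ∶ mset M →
           Γ ⊎ Δ ⊢⟨ b + b′ ⨟ e + e′ ⨟ s + s′ ⟩ t [ u ] ∶ σ

    -- Not a rule of ℰ proper: it makes judgements invariant under the choice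
    -- of the lists representing multisets.  It leaves the term and the
    -- counters unchanged, and is the identity on genuine multisets.
    conv : ∀ {Γ Γ′ b e s t σ σ′} →
           Γ ≋ᶜ Γ′ → σ ≈ σ′ →
           Γ  ⊢⟨ b ⨟ e ⨟ s ⟩ t ∶ σ →
           Γ′ ⊢⟨ b ⨟ e ⨟ s ⟩ t ∶ σ′

  -- Γ ⊢*⟨ b ⨟ e ⨟ s ⟩ t ∶ [σᵢ]ᵢ: a finite family of derivations
  -- Γᵢ ⊢⟨ bᵢ ⨟ eᵢ ⨟ sᵢ ⟩ t ∶ σᵢ, where Γ, b, e, s are the sums of the
  -- Γᵢ, bᵢ, eᵢ, sᵢ.
  data _⊢*⟨_⨟_⨟_⟩_∶_ {n : ℕ} : Ctx n → ℕ → ℕ → ℕ → Term n → Multi → Set where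
    []  : ∀ {t} → ∅ ⊢*⟨ 0 ⨟ 0 ⨟ 0 ⟩ t ∶ []
    _∷_ : ∀ {Γ Δ b e s b′ e′ s′ t σ M} →
          Γ ⊢⟨ b ⨟ e ⨟ s ⟩ t ∶ σ →
          Δ ⊢*⟨ b′ ⨟ e′ ⨟ s′ ⟩ t ∶ M →
          Γ ⊎ Δ ⊢*⟨ b + b′ ⨟ e + e′ ⨟ s + s′ ⟩ t ∶ σ ∷ M

TightDerivation : ∀ {Γ : Ctx n} {b e s t σ} → Γ ⊢⟨ b ⨟ e ⨟ s ⟩ t ∶ σ → Set
TightDerivation {Γ = Γ} {σ = σ} _ = TightCtx Γ × IsTight σ

{-# OPTIONS --safe #-}
-- A derivation assigns to every weak position exactly one subderivation, so
-- contracting a redex removes exactly one unit of the matching counter and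
-- leaves the context, the type and the other counters unchanged.  In a tight
-- context a neutral normal term has a tight type; hence a typed term either
-- has a redex, which its typing rule pays for, or is normal and clash-free with
-- b = e = 0 and s its weak size.  Iterating, b + e decreases at each step.
-- Typing contexts and counters are handled together as elements of one
-- commutative monoid.
module Submission where

open import Defs
open import Algebra.Bundles using (CommutativeMonoid)
import Algebra.Construct.DirectProduct as Product
import Algebra.Properties.CommutativeSemigroup as Semigroup
import Algebra.Solver.CommutativeMonoid as Solver
open import Algebra.Structures.Biased using (isCommutativeMonoidˡ)
open import Data.Fin using (Fin; zero; suc)
open import Data.List using ([]; _∷_; _++_)
open import Data.List.Relation.Binary.Permutation.Homogeneous using (refl; prep; swap; trans)
import Data.List.Relation.Binary.Permutation.Setoid.Properties as Perm
open import Data.List.Relation.Binary.Pointwise as List using ([]; _∷_)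
open import Data.List.Relation.Unary.All using ([]; _∷_)
open import Data.List.Relation.Unary.All.Properties using (++⁻ˡ; ++⁻ʳ)
open import Data.Nat using (ℕ; zero; suc; _+_)
open import Data.Nat.Properties using (+-0-commutativeMonoid; +-comm; +-identityʳ; +-suc; suc-injective)
open import Data.Product using (∃-syntax; _×_; _,_; proj₁; proj₂)
open import Data.Vec using ([]; _∷_)
open import Data.Vec.Relation.Binary.Pointwise.Inductive as Vec using ([]; _∷_)
open import Data.Vec.Relation.Unary.All using ([]; _∷_)
open import Function using (_∘_)
open import Level using (0ℓ)
open import Relation.Binary.Bundles using (Setoid)
open import Relation.Binary.PropositionalEquality as ≡ using (_≡_; _≢_; refl)
import Relation.Binary.Reasoning.Setoid as Reasoning
open import Relation.Nullary using (contradiction)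

private
  variable
    n m : ℕ

-- Equality of types and multisets is an equivalence

mutual
  ≈-refl : ∀ σ → σ ≈ σ
  ≈-refl (tt c)   = tt c
  ≈-refl (mset M) = mset (≋-refl M)
  ≈-refl (M ⇒ σ)  = ≋-refl M ⇒ ≈-refl σ

  ≋-refl : ∀ M → M ≋ M
  ≋-refl []      = refl []
  ≋-refl (σ ∷ M) = prep (≈-refl σ) (≋-refl M)

mutual
  ≈-sym : ∀ {σ τ} → σ ≈ τ → τ ≈ σ
  ≈-sym (tt c)   = tt c
  ≈-sym (mset p) = mset (≋-sym p)
  ≈-sym (p ⇒ q)  = ≋-sym p ⇒ ≈-sym q

  ≋-sym : ∀ {M N} → M ≋ N → N ≋ M
  ≋-sym (refl ps)    = refl (pointwise-sym ps)
  ≋-sym (prep p q)   = prep (≈-sym p) (≋-sym q)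
  ≋-sym (swap p q r) = swap (≈-sym q) (≈-sym p) (≋-sym r)
  ≋-sym (trans p q)  = trans (≋-sym q) (≋-sym p)

  pointwise-sym : ∀ {M N} → List.Pointwise _≈_ M N → List.Pointwise _≈_ N M
  pointwise-sym []       = []
  pointwise-sym (p ∷ ps) = ≈-sym p ∷ pointwise-sym ps

≈-trans : ∀ {σ τ υ} → σ ≈ τ → τ ≈ υ → σ ≈ υ
≈-trans (tt c)   (tt .c)  = tt c
≈-trans (mset p) (mset q) = mset (trans p q)
≈-trans (p ⇒ q)  (r ⇒ s)  = trans p r ⇒ ≈-trans q s

typeSetoid : Setoid 0ℓ 0ℓ
typeSetoid = record
  { Carrier       = Type
  ; _≈_           = _≈_
  ; isEquivalence = record { refl = ≈-refl _ ; sym = ≈-sym ; trans = ≈-trans }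
  }

-- The commutative monoid of contexts and counters

module Multisets = CommutativeMonoid (Perm.++-commutativeMonoid typeSetoid)

contexts : ℕ → CommutativeMonoid 0ℓ 0ℓ
contexts n = record
  { Carrier             = Ctx n
  ; _≈_                 = _≋ᶜ_
  ; _∙_                 = _⊎_
  ; ε                   = ∅
  ; isCommutativeMonoid = isCommutativeMonoidˡ record
    { isSemigroup = record
      { isMagma = record
        { isEquivalence = Vec.isEquivalence Multisets.isEquivalence n
        ; ∙-cong        = Vec.zipWith-cong Multisets.∙-cong
        }
      ; assoc   = Vec.zipWith-assoc Multisets.assoc
      }
    ; identityˡ   = Vec.zipWith-identityˡ Multisets.identityˡ
    ; comm        = Vec.zipWith-comm Multisets.comm
    }
  }

Cost : Set
Cost = ℕ × ℕ × ℕ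

costs : CommutativeMonoid 0ℓ 0ℓ
costs = Product.commutativeMonoid +-0-commutativeMonoid
  (Product.commutativeMonoid +-0-commutativeMonoid +-0-commutativeMonoid)

-- A typing context together with the counters (b , e , s) of a judgement.
Res : ℕ → Set
Res n = Ctx n × Cost

resources : ℕ → CommutativeMonoid 0ℓ 0ℓ
resources n = Product.commutativeMonoid (contexts n) costs

module Ctxs {n} = CommutativeMonoid (contexts n)
module Costs = CommutativeMonoid costs

open module Resources {n} = CommutativeMonoid (resources n)
  using (ε; ∙-cong; ∙-congˡ; ∙-congʳ; assoc; comm; identityˡ; identityʳ)
  renaming (_≈_ to infix 4 _≃_; _∙_ to infixl 6 _∙_; refl to ≃-refl; sym to ≃-sym; trans to ≃-trans)

open module ResourceSolver {n} = Solver (resources n) using (solve; _⊕_; _⊜_)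
module ≃-Reasoning {n} = Reasoning (CommutativeMonoid.setoid (resources n))

infixr 5 _◂_

_◂_ : Multi → Res n → Res (suc n)
M ◂ (Γ , c) = M ∷ Γ , c

free : Ctx n → Res n
free Γ = Γ , 0 , 0 , 0

pure : Cost → Res n
pure c = ∅ , c

unit-size : Cost
unit-size = 0 , 0 , 1

cost : Kind → Cost
cost multiplicative = 1 , 0 , 0
cost exponential    = 0 , 1 , 0

◂-cong : ∀ {M} {r r′ : Res n} → r ≃ r′ → M ◂ r ≃ M ◂ r′
◂-cong (p , q) = ≋-refl _ ∷ p , q

interchange : (r s t u : Res n) → (r ∙ s) ∙ (t ∙ u) ≃ (r ∙ t) ∙ (s ∙ u)
interchange {n} = Semigroup.interchange (CommutativeMonoid.commutativeSemigroup (resources n))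

-- A cost has an empty context, so it contributes nothing to the entry of the bound variable. A
-- payment made below a binder can therefore be moved outside it, which is needed for steps under
-- `ƛ` and on the left of an explicit substitution.
unbind : ∀ {M c} (r : Res n) (r′ : Res (suc n)) → M ◂ r ≃ r′ ∙ pure c →
         ∃[ r″ ] r ≃ r″ ∙ pure c × r′ ≃ M ◂ r″
unbind {n = n} (Γ , _) (N ∷ Γ′ , c′) (p ∷ ps , q) =
  (Γ , c′) , (Ctxs.sym (Ctxs.identityʳ _) , q) ,
  ((≋-sym (trans p (Multisets.identityʳ N))
    ∷ Ctxs.sym (Ctxs.trans ps (Ctxs.identityʳ Γ′))) , Costs.refl)

-- A conversion-free presentation of the type system

infix 4 _⊩_∶_ _⊩*_∶_ _⊩ˢ_∶_

-- Accepts M υ: an argument of type υ may be supplied for a variable of type M.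
data Accepts (M : Multi) : Type → Set where
  consuming  : Accepts M (mset M)
  persistent : TightM M → Accepts M (tt 𝕟)

mutual
  -- System ℰ without the rule conv, which becomes admissible because every
  -- other rule holds up to _≃_.
  data _⊩_∶_ {n} (r : Res n) : Term n → Type → Set where
    var   : ∀ {i σ} → r ≃ free (i ∶[ σ ]) → r ⊩ var i ∶ σ
    app-p : ∀ {r₁ r₂ t u ā} → r₁ ⊩ t ∶ tt 𝕟 → r₂ ⊩ u ∶ tt ā → ā ≢ 𝕒 →
            r ≃ (r₁ ∙ r₂) ∙ pure unit-size → r ⊩ t · u ∶ tt 𝕟
    app-c : ∀ {r₁ r₂ t u M υ τ} → r₁ ⊩ t ∶ M ⇒ τ → r₂ ⊩ u ∶ υ → Accepts M υ →
            r ≃ (r₁ ∙ r₂) ∙ pure (cost multiplicative) → r ⊩ t · u ∶ τ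
    lam-p : ∀ {r₁ M t c} → M ◂ r₁ ⊩ t ∶ tt c → TightM M →
            r ≃ r₁ ∙ pure unit-size → r ⊩ ƛ t ∶ tt 𝕒
    lam-c : ∀ {M t τ} → M ◂ r ⊩ t ∶ τ → r ⊩ ƛ t ∶ M ⇒ τ
    bang-p : ∀ {t} → r ≃ ε → r ⊩ ! t ∶ tt 𝕓
    bang-c : ∀ {r₁ M t} → r₁ ⊩* t ∶ M → r ≃ r₁ ∙ pure (cost exponential) →
             r ⊩ ! t ∶ mset M
    der-p : ∀ {r₁ t} → r₁ ⊩ t ∶ tt 𝕟 → r ≃ r₁ ∙ pure unit-size →
            r ⊩ der t ∶ tt 𝕟
    der-c : ∀ {t σ} → r ⊩ t ∶ mset (σ ∷ []) → r ⊩ der t ∶ σ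
    sub   : ∀ {r₁ r₂ t u M υ τ} → M ◂ r₁ ⊩ t ∶ τ → r₂ ⊩ u ∶ υ → Accepts M υ →
            r ≃ r₁ ∙ r₂ → r ⊩ t [ u ] ∶ τ

  data _⊩*_∶_ {n} (r : Res n) (t : Term n) : Multi → Set where
    nil  : r ≃ ε → r ⊩* t ∶ []
    cons : ∀ {r₁ r₂ σ M} → r₁ ⊩ t ∶ σ → r₂ ⊩* t ∶ M → r ≃ r₁ ∙ r₂ →
           r ⊩* t ∶ σ ∷ M

-- Admissibility of conversion

⊩-resp : ∀ {r r′ : Res n} {t σ} → r ≃ r′ → r ⊩ t ∶ σ → r′ ⊩ t ∶ σ
⊩-resp e (var p)           = var (≃-trans (≃-sym e) p)
⊩-resp e (app-p d d′ x p)  = app-p d d′ x (≃-trans (≃-sym e) p)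
⊩-resp e (app-c d d′ x p)  = app-c d d′ x (≃-trans (≃-sym e) p)
⊩-resp e (lam-p d x p)     = lam-p d x (≃-trans (≃-sym e) p)
⊩-resp e (lam-c d)         = lam-c (⊩-resp (◂-cong e) d)
⊩-resp e (bang-p p)        = bang-p (≃-trans (≃-sym e) p)
⊩-resp e (bang-c ds p)     = bang-c ds (≃-trans (≃-sym e) p)
⊩-resp e (der-p d p)       = der-p d (≃-trans (≃-sym e) p)
⊩-resp e (der-c d)         = der-c (⊩-resp e d)
⊩-resp e (sub d d′ x p)    = sub d d′ x (≃-trans (≃-sym e) p)

⊩*-resp : ∀ {r r′ : Res n} {t M} → r ≃ r′ → r ⊩* t ∶ M → r′ ⊩* t ∶ M
⊩*-resp e (nil p)       = nil (≃-trans (≃-sym e) p)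
⊩*-resp e (cons d ds p) = cons d ds (≃-trans (≃-sym e) p)

∶[]-cong : ∀ (i : Fin n) {σ τ} → σ ≈ τ → i ∶[ σ ] ≋ᶜ i ∶[ τ ]
∶[]-cong zero    p = prep p (refl []) ∷ Ctxs.refl
∶[]-cong (suc i) p = refl [] ∷ ∶[]-cong i p

-- The term is an explicit argument because it is what decreases when these
-- functions call each other.
mutual
  ⊩-conv : ∀ {r : Res n} t {σ τ} → σ ≈ τ → r ⊩ t ∶ σ → r ⊩ t ∶ τ
  -- A tight constant is equal only to itself; this disposes of all rules whose conclusion has a
  -- fixed constant as its type.
  ⊩-conv _         (tt c)   d                = d
  ⊩-conv (var i)   e        (var (p , q))    = var (Ctxs.trans p (∶[]-cong i e) , q)
  ⊩-conv (t · u)   e        (app-c d d′ x p) = app-c (⊩-conv t (≋-refl _ ⇒ e) d) d′ x p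
  -- The domain of the arrow is the entry of the bound variable, so converting it amounts to
  -- changing the resource of the premise.
  ⊩-conv (ƛ t)     (p ⇒ e)  (lam-c d)        =
    lam-c (⊩-conv t e (⊩-resp ((p ∷ Ctxs.refl) , Costs.refl) d))
  ⊩-conv (! t)     (mset p) (bang-c ds q)    = bang-c (⊩*-conv t p ds) q
  ⊩-conv (der t)   e        (der-c d)        = der-c (⊩-conv t (mset (prep e (refl []))) d)
  ⊩-conv (t [ u ]) e        (sub d d′ x p)   = sub (⊩-conv t e d) d′ x p

  ⊩*-conv : ∀ {r : Res n} t {M N} → M ≋ N → r ⊩* t ∶ M → r ⊩* t ∶ N
  ⊩*-conv t (refl ps)     ds = ⊩*-pointwise t ps ds
  ⊩*-conv t (prep p q)    (cons d ds e) = cons (⊩-conv t p d) (⊩*-conv t q ds) e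
  ⊩*-conv t (swap p p′ q) (cons {r₁ = r₁} d (cons {r₁ = r₂} {r₂ = r₃} d′ ds e′) e) =
    cons (⊩-conv t p′ d′) (cons (⊩-conv t p d) (⊩*-conv t q ds) ≃-refl)
      (≃-trans e (≃-trans (∙-congˡ e′)
        (solve 3 (λ a b c → a ⊕ (b ⊕ c) ⊜ b ⊕ (a ⊕ c)) ≃-refl r₁ r₂ r₃)))
  ⊩*-conv t (trans p q)   ds = ⊩*-conv t q (⊩*-conv t p ds)

  ⊩*-pointwise : ∀ {r : Res n} t {M N} → List.Pointwise _≈_ M N → r ⊩* t ∶ M → r ⊩* t ∶ N
  ⊩*-pointwise t []       ds            = ds
  ⊩*-pointwise t (p ∷ ps) (cons d ds e) = cons (⊩-conv t p d) (⊩*-pointwise t ps ds) e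

-- Translation from system ℰ

unit-paid : ∀ {Γ : Ctx n} {b e s} → (Γ , b , e , s + 1) ≃ (Γ , b , e , s) ∙ pure unit-size
unit-paid = Ctxs.sym (Ctxs.identityʳ _) , ≡.sym (+-identityʳ _) , ≡.sym (+-identityʳ _) , refl

dB-paid : ∀ {Γ : Ctx n} {b e s} → (Γ , b + 1 , e , s) ≃ (Γ , b , e , s) ∙ pure (cost multiplicative)
dB-paid = Ctxs.sym (Ctxs.identityʳ _) , refl , ≡.sym (+-identityʳ _) , ≡.sym (+-identityʳ _)

mutual
  ⊢⇒⊩ : ∀ {Γ : Ctx n} {b e s t σ} → Γ ⊢⟨ b ⨟ e ⨟ s ⟩ t ∶ σ → (Γ , b , e , s) ⊩ t ∶ σ
  ⊢⇒⊩ (ae-p d d′ x) = app-p (⊢⇒⊩ d) (⊢⇒⊩ d′) x unit-paid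
  ⊢⇒⊩ (ai-p d x) = lam-p (⊢⇒⊩ d) x unit-paid
  ⊢⇒⊩ bg-p = bang-p ≃-refl
  ⊢⇒⊩ (dr-p d) = der-p (⊢⇒⊩ d) unit-paid
  ⊢⇒⊩ (es-p d d′ x) = sub (⊢⇒⊩ d) (⊢⇒⊩ d′) (persistent x) ≃-refl
  ⊢⇒⊩ ax-c = var ≃-refl
  ⊢⇒⊩ (ae-c₁ d d′) = app-c (⊢⇒⊩ d) (⊢⇒⊩ d′) consuming dB-paid
  ⊢⇒⊩ (ae-c₂ d d′ x) = app-c (⊢⇒⊩ d) (⊢⇒⊩ d′) (persistent x) dB-paid
  ⊢⇒⊩ (ai-c d) = lam-c (⊢⇒⊩ d)
  ⊢⇒⊩ (bg-c {e = e} ds) = bang-c (⊢*⇒⊩* ds)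
    (Ctxs.sym (Ctxs.identityʳ _) , ≡.sym (+-identityʳ _) , +-comm 1 e , ≡.sym (+-identityʳ _))
  ⊢⇒⊩ (dr-c d) = der-c (⊢⇒⊩ d)
  ⊢⇒⊩ (es-c d d′) = sub (⊢⇒⊩ d) (⊢⇒⊩ d′) consuming ≃-refl
  ⊢⇒⊩ (conv p q d) = ⊩-conv _ q (⊩-resp (p , Costs.refl) (⊢⇒⊩ d))

  ⊢*⇒⊩* : ∀ {Γ : Ctx n} {b e s t M} → Γ ⊢*⟨ b ⨟ e ⨟ s ⟩ t ∶ M → (Γ , b , e , s) ⊩* t ∶ M
  ⊢*⇒⊩* []       = nil ≃-refl
  ⊢*⇒⊩* (d ∷ ds) = cons (⊢⇒⊩ d) (⊢*⇒⊩* ds) ≃-refl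

-- Typed substitutions and their splitting

-- q ⊩ˢ θ ∶ r: θ supplies, for each variable, one derivation per element of
-- its multiset in r; q collects their resources and the counters of r.
data _⊩ˢ_∶_ {m} (q : Res m) : (Fin n → Term m) → Res n → Set where
  nil  : ∀ {θ : Fin 0 → Term m} {c} → q ≃ pure c → q ⊩ˢ θ ∶ ([] , c)
  cons : ∀ {q₁ q₂ M Γ c} {θ : Fin (suc n) → Term m} → q₁ ⊩* θ zero ∶ M →
         q₂ ⊩ˢ θ ∘ suc ∶ (Γ , c) → q ≃ q₁ ∙ q₂ → q ⊩ˢ θ ∶ (M ∷ Γ , c)

⊩ˢ-resp : ∀ {q q′ : Res m} {θ : Fin n → Term m} {r} → q ≃ q′ → q ⊩ˢ θ ∶ r → q′ ⊩ˢ θ ∶ r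
⊩ˢ-resp e (nil p)       = nil (≃-trans (≃-sym e) p)
⊩ˢ-resp e (cons d ds p) = cons d ds (≃-trans (≃-sym e) p)

⊩ˢ-conv : ∀ {q : Res m} {θ : Fin n → Term m} {r r′} → r ≃ r′ → q ⊩ˢ θ ∶ r → q ⊩ˢ θ ∶ r′
⊩ˢ-conv ([] , k)     (nil p)       = nil (≃-trans p (Ctxs.refl , k))
⊩ˢ-conv (p ∷ ps , k) (cons d ds e) = cons (⊩*-conv _ p d) (⊩ˢ-conv (ps , k) ds) e

⊩*-split : ∀ {r : Res n} {t} M {N} → r ⊩* t ∶ M ++ N →
           ∃[ r₁ ] ∃[ r₂ ] (r₁ ⊩* t ∶ M × r₂ ⊩* t ∶ N × r ≃ r₁ ∙ r₂)
⊩*-split []      ds = _ , _ , nil ≃-refl , ds , ≃-sym (identityˡ _)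
⊩*-split (σ ∷ M) (cons {r₁ = a} d ds e) with ⊩*-split M ds
... | r₁ , r₂ , ds₁ , ds₂ , e′ =
  a ∙ r₁ , r₂ , cons d ds₁ ≃-refl , ds₂ ,
  ≃-trans e (≃-trans (∙-congˡ e′) (≃-sym (assoc a r₁ r₂)))

-- The family supplied for each variable is cut where its two multisets meet, and the resources
-- regroup by `interchange`. This distributes one substitution over the premises of a rule without
-- duplicating any derivation.
⊩ˢ-split : ∀ {q : Res m} {θ : Fin n → Term m} r₁ r₂ → q ⊩ˢ θ ∶ r₁ ∙ r₂ →
           ∃[ q₁ ] ∃[ q₂ ] (q₁ ⊩ˢ θ ∶ r₁ × q₂ ⊩ˢ θ ∶ r₂ × q ≃ q₁ ∙ q₂)
⊩ˢ-split ([] , c₁) ([] , c₂) (nil p) =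
  pure c₁ , pure c₂ , nil ≃-refl , nil ≃-refl ,
  ≃-trans p (Ctxs.sym (Ctxs.identityˡ ∅) , Costs.refl)
⊩ˢ-split (M ∷ Γ , c₁) (N ∷ Δ , c₂) (cons d ds e)
  with ⊩*-split M d | ⊩ˢ-split (Γ , c₁) (Δ , c₂) ds
... | a₁ , a₂ , d₁ , d₂ , p | b₁ , b₂ , ds₁ , ds₂ , p′ =
  a₁ ∙ b₁ , a₂ ∙ b₂ , cons d₁ ds₁ ≃-refl , cons d₂ ds₂ ≃-refl ,
  ≃-trans e (≃-trans (∙-cong p p′) (interchange a₁ a₂ b₁ b₂))

⊩ˢ-pure : ∀ {q : Res m} {θ : Fin n → Term m} {c} → q ⊩ˢ θ ∶ pure c → q ≃ pure c
⊩ˢ-pure {n = zero}  (nil p)             = p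
⊩ˢ-pure {n = suc _} (cons (nil p) ds e) =
  ≃-trans e (≃-trans (∙-cong p (⊩ˢ-pure ds)) (identityˡ _))

⊩ˢ-lookup : ∀ {q : Res m} {θ : Fin n → Term m} i {σ} → q ⊩ˢ θ ∶ free (i ∶[ σ ]) → q ⊩ θ i ∶ σ
⊩ˢ-lookup zero (cons {q₂ = q₂} (cons {r₁ = a} d (nil p) e′) ds e) = ⊩-resp
  (≃-sym (≃-trans e (≃-trans (∙-cong (≃-trans e′ (∙-congˡ p)) (⊩ˢ-pure ds))
    (solve 1 (λ x → (x ⊕ ResourceSolver.id) ⊕ ResourceSolver.id ⊜ x) ≃-refl a)))) d
⊩ˢ-lookup (suc i) (cons (nil p) ds e) = ⊩-resp
  (≃-sym (≃-trans e (≃-trans (∙-congʳ p) (identityˡ _)))) (⊩ˢ-lookup i ds)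

-- Renaming

weaken-var : ∀ {q : Res n} {i M} → q ⊩* var i ∶ M → [] ◂ q ⊩* var (suc i) ∶ M
weaken-var (nil p)                = nil (◂-cong p)
weaken-var (cons (var p) ds e)    = cons (var (◂-cong p)) (weaken-var ds) (◂-cong e)

-- Weakening is done for variables first: this is enough to push a renaming under a binder, and
-- renaming then yields the weakening of arbitrary terms in `weaken-⊩ˢ`.
weaken-vars : ∀ {q : Res m} {ρ : Fin n → Fin m} {r} →
              q ⊩ˢ var ∘ ρ ∶ r → [] ◂ q ⊩ˢ (λ i → var (suc (ρ i))) ∶ r
weaken-vars (nil p)       = nil (◂-cong p)
weaken-vars (cons d ds e) = cons (weaken-var d) (weaken-vars ds) (◂-cong e)

bound-var : ∀ M → free (M ∷ ∅ {n}) ⊩* var zero ∶ M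
bound-var []      = nil ≃-refl
bound-var (σ ∷ M) = cons (var ≃-refl) (bound-var M) (Ctxs.sym (Ctxs.identityˡ _) , refl , refl , refl)

bound-var-∙ : ∀ M (q : Res n) → M ◂ q ≃ free (M ∷ ∅) ∙ ([] ◂ q)
bound-var-∙ M q = ≋-sym (Multisets.identityʳ M) ∷ Ctxs.sym (Ctxs.identityˡ _) , Costs.refl

lift-vars : ∀ {q : Res m} {ρ : Fin n → Fin m} {M r} →
            q ⊩ˢ var ∘ ρ ∶ r → M ◂ q ⊩ˢ var ∘ liftᴿ ρ ∶ M ◂ r
lift-vars {M = M} ds = cons (bound-var M) (weaken-vars ds) (bound-var-∙ M _)

id-vars : (r : Res n) → r ⊩ˢ var ∶ r
id-vars ([] , c)    = nil ≃-refl
id-vars (M ∷ Γ , c) = cons (bound-var M) (weaken-vars (id-vars (Γ , c))) (bound-var-∙ M _)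

⊩ˢ-split-paid : ∀ {q : Res m} {θ : Fin n → Term m} {r} r₁ {c} → r ≃ r₁ ∙ pure c → q ⊩ˢ θ ∶ r →
                ∃[ q₁ ] (q₁ ⊩ˢ θ ∶ r₁ × q ≃ q₁ ∙ pure c)
⊩ˢ-split-paid r₁ p ds with ⊩ˢ-split r₁ _ (⊩ˢ-conv p ds)
... | q₁ , q₂ , ds₁ , ds₂ , e = q₁ , ds₁ , ≃-trans e (∙-congˡ (⊩ˢ-pure ds₂))

mutual
  -- A renaming is treated as a substitution by variables. These cost nothing, so the counters are
  -- preserved; if `ρ` identifies variables, their multisets are added.
  rename-⊩ : ∀ {q : Res m} {r : Res n} {ρ t σ} → q ⊩ˢ var ∘ ρ ∶ r → r ⊩ t ∶ σ → q ⊩ rename ρ t ∶ σ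
  rename-⊩ ds (var p) = ⊩ˢ-lookup _ (⊩ˢ-conv p ds)
  rename-⊩ ds (app-p {r₁} {r₂} d d′ x p) with ⊩ˢ-split-paid (r₁ ∙ r₂) p ds
  ... | _ , ds′ , e with ⊩ˢ-split r₁ r₂ ds′
  ... | _ , _ , ds₁ , ds₂ , e′ = app-p (rename-⊩ ds₁ d) (rename-⊩ ds₂ d′) x (≃-trans e (∙-congʳ e′))
  rename-⊩ ds (app-c {r₁} {r₂} d d′ x p) with ⊩ˢ-split-paid (r₁ ∙ r₂) p ds
  ... | _ , ds′ , e with ⊩ˢ-split r₁ r₂ ds′
  ... | _ , _ , ds₁ , ds₂ , e′ = app-c (rename-⊩ ds₁ d) (rename-⊩ ds₂ d′) x (≃-trans e (∙-congʳ e′))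
  rename-⊩ ds (lam-p {r₁} d x p) with ⊩ˢ-split-paid r₁ p ds
  ... | _ , ds′ , e = lam-p (rename-⊩ (lift-vars ds′) d) x e
  rename-⊩ ds (lam-c d) = lam-c (rename-⊩ (lift-vars ds) d)
  rename-⊩ ds (bang-p p) = bang-p (⊩ˢ-pure (⊩ˢ-conv p ds))
  rename-⊩ ds (bang-c {r₁} d p) with ⊩ˢ-split-paid r₁ p ds
  ... | _ , ds′ , e = bang-c (rename-⊩* ds′ d) e
  rename-⊩ ds (der-p {r₁} d p) with ⊩ˢ-split-paid r₁ p ds
  ... | _ , ds′ , e = der-p (rename-⊩ ds′ d) e
  rename-⊩ ds (der-c d) = der-c (rename-⊩ ds d)
  rename-⊩ ds (sub {r₁} {r₂} d d′ x p) with ⊩ˢ-split r₁ r₂ (⊩ˢ-conv p ds)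
  ... | _ , _ , ds₁ , ds₂ , e = sub (rename-⊩ (lift-vars ds₁) d) (rename-⊩ ds₂ d′) x e

  rename-⊩* : ∀ {q : Res m} {r : Res n} {ρ t M} →
              q ⊩ˢ var ∘ ρ ∶ r → r ⊩* t ∶ M → q ⊩* rename ρ t ∶ M
  rename-⊩* ds (nil p) = nil (⊩ˢ-pure (⊩ˢ-conv p ds))
  rename-⊩* ds (cons {r₁} {r₂} d d′ p) with ⊩ˢ-split r₁ r₂ (⊩ˢ-conv p ds)
  ... | _ , _ , ds₁ , ds₂ , e = cons (rename-⊩ ds₁ d) (rename-⊩* ds₂ d′) e

-- Substitution

weaken-⊩ˢ : ∀ {q : Res m} {θ : Fin n → Term m} {r} → q ⊩ˢ θ ∶ r → [] ◂ q ⊩ˢ rename suc ∘ θ ∶ r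
weaken-⊩ˢ (nil p)       = nil (◂-cong p)
weaken-⊩ˢ (cons d ds e) = cons (rename-⊩* (weaken-vars (id-vars _)) d) (weaken-⊩ˢ ds) (◂-cong e)

lift-⊩ˢ : ∀ {q : Res m} {θ : Fin n → Term m} {M r} → q ⊩ˢ θ ∶ r → M ◂ q ⊩ˢ liftˢ θ ∶ M ◂ r
lift-⊩ˢ {M = M} ds = cons (bound-var M) (weaken-⊩ˢ ds) (bound-var-∙ M _)

mutual
  -- Every element of a variable's multiset is consumed by exactly one axiom, which is replaced by
  -- the derivation supplied for it. Hence the counters simply add up.
  subst-⊩ : ∀ {q : Res m} {r : Res n} {θ t σ} → q ⊩ˢ θ ∶ r → r ⊩ t ∶ σ → q ⊩ subst θ t ∶ σ
  subst-⊩ ds (var p) = ⊩ˢ-lookup _ (⊩ˢ-conv p ds)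
  subst-⊩ ds (app-p {r₁} {r₂} d d′ x p) with ⊩ˢ-split-paid (r₁ ∙ r₂) p ds
  ... | _ , ds′ , e with ⊩ˢ-split r₁ r₂ ds′
  ... | _ , _ , ds₁ , ds₂ , e′ = app-p (subst-⊩ ds₁ d) (subst-⊩ ds₂ d′) x (≃-trans e (∙-congʳ e′))
  subst-⊩ ds (app-c {r₁} {r₂} d d′ x p) with ⊩ˢ-split-paid (r₁ ∙ r₂) p ds
  ... | _ , ds′ , e with ⊩ˢ-split r₁ r₂ ds′
  ... | _ , _ , ds₁ , ds₂ , e′ = app-c (subst-⊩ ds₁ d) (subst-⊩ ds₂ d′) x (≃-trans e (∙-congʳ e′))
  subst-⊩ ds (lam-p {r₁} d x p) with ⊩ˢ-split-paid r₁ p ds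
  ... | _ , ds′ , e = lam-p (subst-⊩ (lift-⊩ˢ ds′) d) x e
  subst-⊩ ds (lam-c d) = lam-c (subst-⊩ (lift-⊩ˢ ds) d)
  subst-⊩ ds (bang-p p) = bang-p (⊩ˢ-pure (⊩ˢ-conv p ds))
  subst-⊩ ds (bang-c {r₁} d p) with ⊩ˢ-split-paid r₁ p ds
  ... | _ , ds′ , e = bang-c (subst-⊩* ds′ d) e
  subst-⊩ ds (der-p {r₁} d p) with ⊩ˢ-split-paid r₁ p ds
  ... | _ , ds′ , e = der-p (subst-⊩ ds′ d) e
  subst-⊩ ds (der-c d) = der-c (subst-⊩ ds d)
  subst-⊩ ds (sub {r₁} {r₂} d d′ x p) with ⊩ˢ-split r₁ r₂ (⊩ˢ-conv p ds)
  ... | _ , _ , ds₁ , ds₂ , e = sub (subst-⊩ (lift-⊩ˢ ds₁) d) (subst-⊩ ds₂ d′) x e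

  subst-⊩* : ∀ {q : Res m} {r : Res n} {θ t M} → q ⊩ˢ θ ∶ r → r ⊩* t ∶ M → q ⊩* subst θ t ∶ M
  subst-⊩* ds (nil p) = nil (⊩ˢ-pure (⊩ˢ-conv p ds))
  subst-⊩* ds (cons {r₁} {r₂} d d′ p) with ⊩ˢ-split r₁ r₂ (⊩ˢ-conv p ds)
  ... | _ , _ , ds₁ , ds₂ , e = cons (subst-⊩ ds₁ d) (subst-⊩* ds₂ d′) e

-- Quantitative subject reduction for the three rules

extractˡ : ∀ {r r₁ : Res n} r₁′ y c → r ≃ r₁ ∙ y → r₁ ≃ r₁′ ∙ pure c → r ≃ (r₁′ ∙ y) ∙ pure c
extractˡ r₁′ y c p q = ≃-trans p (≃-trans (∙-congʳ {x = y} q)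
  (solve 3 (λ a b c → (a ⊕ c) ⊕ b ⊜ (a ⊕ b) ⊕ c) ≃-refl r₁′ y (pure c)))

extractʳ : ∀ {r r₂ : Res n} y r₂′ c → r ≃ y ∙ r₂ → r₂ ≃ r₂′ ∙ pure c → r ≃ (y ∙ r₂′) ∙ pure c
extractʳ y r₂′ c p q = ≃-trans p (≃-trans (∙-congˡ {x = y} q) (≃-sym (assoc y r₂′ (pure c))))

-- A derivation for L ⟨ v ⟩ᴸ split into one for v and the rest, r₀.  In plug,
-- q is a resource of the outer scope that v′ uses from under the binders of L.
record Focus (L : LCtx n m) (r : Res n) (v : Term m) (σ : Type) : Set where
  field
    Γ     : Ctx m
    k     : Cost
    r₀    : Res n
    body  : (Γ , k) ⊩ v ∶ σ
    total : r ≃ r₀ ∙ pure k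
    plug  : ∀ c q {v′ σ′} →
            (∀ {q′} → q′ ⊩ˢ var ∘ under L ∶ q → (Γ , c) ∙ q′ ⊩ v′ ∶ σ′) →
            (r₀ ∙ pure c) ∙ q ⊩ L ⟨ v′ ⟩ᴸ ∶ σ′

open Focus

focus : ∀ (L : LCtx n m) {r v σ} → r ⊩ L ⟨ v ⟩ᴸ ∶ σ → Focus L r v σ
focus □ {Γ , k} d = record
  { Γ     = Γ
  ; k     = k
  -- The context used by `v` stays in `r₀`; only its counters go to `k`, since a contraction can
  -- lower these.
  ; r₀    = free Γ
  ; body  = d
  ; total = Ctxs.sym (Ctxs.identityʳ Γ) , Costs.refl
  ; plug  = λ c q f → ⊩-resp (∙-congʳ {x = q} (Ctxs.sym (Ctxs.identityʳ Γ) , Costs.refl)) (f (id-vars q))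
  }
focus (L [ w ]) (sub {r₁} {r₂} {M = M} d d′ x p) with focus L d
-- The inner `r₀` still contains the entry `M` of the variable bound here; it is taken off before
-- `r₂` is added.
... | h with unbind r₁ (h .r₀) (h .total)
... | r₁′ , e , e′ = record
  { Γ     = h .Γ
  ; k     = h .k
  ; r₀    = r₁′ ∙ r₂
  ; body  = h .body
  ; total = extractˡ r₁′ r₂ (h .k) p e
  ; plug  = λ c q f → ⊩-resp
      (solve 4 (λ a b c q → ((a ⊕ c) ⊕ q) ⊕ b ⊜ ((a ⊕ b) ⊕ c) ⊕ q) ≃-refl r₁′ r₂ (pure c) q)
      (sub
        (⊩-resp
          (≃-trans (∙-congʳ {x = [] ◂ q} (∙-congʳ {x = pure c} e′))
            -- Neither the cost `c` nor the outer resource `q` mentions the variable bound here, so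
            -- its entry remains `M` and `d′` still fits.
            (Multisets.trans (Multisets.identityʳ (M ++ [])) (Multisets.identityʳ M) ∷ Ctxs.refl , Costs.refl))
          (h .plug c ([] ◂ q) (λ ds → f (discard ds))))
        d′ x ≃-refl)
  }
  where
  discard : ∀ {m} {q′ : Res m} {θ q} → q′ ⊩ˢ θ ∶ [] ◂ q → q′ ⊩ˢ θ ∘ suc ∶ q
  discard (cons (nil p) ds e) = ⊩ˢ-resp (≃-sym (≃-trans e (≃-trans (∙-congʳ p) (identityˡ _)))) ds

-- An abstraction of arrow type can only come from `lam-c`, whose premise is the first premise of
-- `sub`. The argument is accepted under the same condition before and after, so the contraction
-- saves precisely the unit charged by `app-c`.
dB-⊩ : ∀ (L : LCtx n m) {r₁ r₂ t u M υ τ} →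
       r₁ ⊩ L ⟨ ƛ t ⟩ᴸ ∶ M ⇒ τ → r₂ ⊩ u ∶ υ → Accepts M υ →
       r₁ ∙ r₂ ⊩ L ⟨ t [ rename (under L) u ] ⟩ᴸ ∶ τ
dB-⊩ L {r₂ = r₂} d d′ x with focus L d
... | h with h .body
... | lam-c d₀ = ⊩-resp (∙-congʳ (≃-sym (h .total)))
  (h .plug (h .k) r₂ (λ ds → sub d₀ (rename-⊩ ds d′) x ≃-refl))

pure-∙ : ∀ (r : Res n) {c d k} → k Costs.≈ c Costs.∙ d → r ∙ pure k ≃ (r ∙ pure c) ∙ pure d
pure-∙ r {c} {d} p = ≃-trans
  (∙-congˡ {x = r} (Ctxs.sym (Ctxs.identityˡ ∅) , p)) (≃-sym (assoc r (pure c) (pure d)))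

-- The family under `bang-c` is exactly what the bound variable of `t` demands. Plugging with the
-- family's cost `c` in place of the cost `k` of the bang frees the exponential unit.
s!-⊩ : ∀ (L : LCtx n m) {r₁ r₂ t u M σ} →
       M ◂ r₁ ⊩ t ∶ σ → r₂ ⊩ L ⟨ ! u ⟩ᴸ ∶ mset M →
       ∃[ r′ ] (r′ ⊩ L ⟨ rename (liftᴿ (under L)) t ⟪ u ⟫ ⟩ᴸ ∶ σ ×
                r₁ ∙ r₂ ≃ r′ ∙ pure (cost exponential))
s!-⊩ L {r₁} {r₂} d d′ with focus L d′
... | h with h .body
... | bang-c {Γ , c} ds (p , q) =
  (h .r₀ ∙ pure c) ∙ r₁ ,
  h .plug c r₁ (λ {q′} vs → ⊩-resp
    (∙-congʳ {x = q′} {x = Γ , c} (Ctxs.sym (Ctxs.trans p (Ctxs.identityʳ _)) , Costs.refl))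
    (subst-⊩ (cons ds (id-vars q′) ≃-refl) (rename-⊩ (lift-vars vs) d))) ,
  ≃-trans (comm r₁ r₂)
    (extractˡ (h .r₀ ∙ pure c) r₁ (cost exponential) ≃-refl (≃-trans (h .total) (pure-∙ (h .r₀) q)))

d!-⊩ : ∀ (L : LCtx n m) {r t σ} → r ⊩ L ⟨ ! t ⟩ᴸ ∶ mset (σ ∷ []) →
       ∃[ r′ ] (r′ ⊩ L ⟨ t ⟩ᴸ ∶ σ × r ≃ r′ ∙ pure (cost exponential))
d!-⊩ L d with focus L d
... | h with h .body
... | bang-c {Γ , c} (cons {r₁ = r₁} d₀ (nil e₀) e) (p , q) =
  h .r₀ ∙ pure c ,
  -- No outside term moves under `L` in this rule, so the outer resource is `ε`.
  ⊩-resp (identityʳ (h .r₀ ∙ pure c)) (h .plug c ε (λ {q′} vs → ⊩-resp (begin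
    r₁               ≈⟨ identityʳ r₁ ⟨
    r₁ ∙ ε           ≈⟨ ∙-congˡ {x = r₁} e₀ ⟨
    r₁ ∙ _           ≈⟨ e ⟨
    (Γ , c)          ≈⟨ Ctxs.trans p (Ctxs.identityʳ Γ) , Costs.refl ⟨
    (h .Focus.Γ , c) ≈⟨ identityʳ _ ⟨
    (h .Focus.Γ , c) ∙ ε  ≈⟨ ∙-congˡ {x = h .Focus.Γ , c} (⊩ˢ-pure vs) ⟨
    (h .Focus.Γ , c) ∙ q′ ∎) d₀)) ,
  ≃-trans (h .total) (pure-∙ (h .r₀) q)
  where open ≃-Reasoning

-- Weak steps in compound terms, and normal forms

·ˡ-cong : ∀ {κ} {t t′ u : Term n} → t →w⟨ κ ⟩ t′ → t · u →w⟨ κ ⟩ t′ · u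
·ˡ-cong (weak W x) = weak (W ·ˡ _) x

·ʳ-cong : ∀ {κ} {t u u′ : Term n} → u →w⟨ κ ⟩ u′ → t · u →w⟨ κ ⟩ t · u′
·ʳ-cong (weak W x) = weak (_ ·ʳ W) x

ƛ-cong : ∀ {κ} {t t′ : Term (suc n)} → t →w⟨ κ ⟩ t′ → ƛ t →w⟨ κ ⟩ ƛ t′
ƛ-cong (weak W x) = weak (ƛ W) x

der-cong : ∀ {κ} {t t′ : Term n} → t →w⟨ κ ⟩ t′ → der t →w⟨ κ ⟩ der t′
der-cong (weak W x) = weak (der W) x

[]ˡ-cong : ∀ {κ} {t t′ : Term (suc n)} {u} → t →w⟨ κ ⟩ t′ → t [ u ] →w⟨ κ ⟩ t′ [ u ]
[]ˡ-cong (weak W x) = weak (W [ _ ]ˡ) x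

[]ʳ-cong : ∀ {κ} {t : Term (suc n)} {u u′} → u →w⟨ κ ⟩ u′ → t [ u ] →w⟨ κ ⟩ t [ u′ ]
[]ʳ-cong (weak W x) = weak (_ [ W ]ʳ) x

-- Normal forms are sorted by the tight constant typing them. Neutral terms appear at every constant
-- because a variable may have any of them; only they appear at `𝕟`, which is what excludes clashes.
data Normal {n} : TightConst → Term n → Set where
  ne : ∀ {c t} → Ne-wcf t → Normal c t
  na : ∀ {t} → Na-wcf t → Normal 𝕓 t
  nb : ∀ {t} → Nb-wcf t → Normal 𝕒 t

neutral : ∀ {t : Term n} → Normal 𝕟 t → Ne-wcf t
neutral (ne x) = x

non-abstraction : ∀ {c} {t : Term n} → c ≢ 𝕒 → Normal c t → Na-wcf t
non-abstraction _ (ne x) = ne x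
non-abstraction _ (na x) = x
non-abstraction f (nb _) = contradiction refl f

Normal⇒No-wcf : ∀ {c} {t : Term n} → Normal c t → No-wcf t
Normal⇒No-wcf (ne x) = na (ne x)
Normal⇒No-wcf (na x) = na x
Normal⇒No-wcf (nb x) = nb x

normal-sub : ∀ {c} {t : Term (suc n)} {u} → Normal c t → Ne-wcf u → Normal c (t [ u ])
normal-sub (ne x) y = ne (x [ y ])
normal-sub (na x) y = na (x [ y ])
normal-sub (nb x) y = nb (x [ y ])

-- Progress in tight contexts

-- bang and lam say nothing about the counters: a term of such a type is not
-- required to be normal, since the constructor around it forms a redex with it.
data Outcome {n} (r : Res n) : Term n → Type → Set where
  step   : ∀ {κ t u σ r′} → t →w⟨ κ ⟩ u → r′ ⊩ u ∶ σ →
           r ≃ r′ ∙ pure (cost κ) → Outcome r t σ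
  normal : ∀ {c t} → Normal c t → proj₂ r Costs.≈ (0 , 0 , ∣ t ∣w) → Outcome r t (tt c)
  bang   : ∀ {m M} (L : LCtx n m) u → Outcome r (L ⟨ ! u ⟩ᴸ) (mset M)
  lam    : ∀ {m M τ} (L : LCtx n m) u → Outcome r (L ⟨ ƛ u ⟩ᴸ) (M ⇒ τ)

IsTight-resp : ∀ {σ τ} → σ ≈ τ → IsTight σ → IsTight τ
IsTight-resp (tt c) x = x

TightCtx-resp : ∀ {Γ Δ : Ctx n} → Γ ≋ᶜ Δ → TightCtx Γ → TightCtx Δ
TightCtx-resp []       []       = []
TightCtx-resp (p ∷ ps) (x ∷ xs) = Perm.All-resp-↭ typeSetoid IsTight-resp p x ∷ TightCtx-resp ps xs

TightCtx-⊎⁻ : ∀ (Γ Δ : Ctx n) → TightCtx (Γ ⊎ Δ) → TightCtx Γ × TightCtx Δ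
TightCtx-⊎⁻ []      []      []       = [] , []
TightCtx-⊎⁻ (M ∷ Γ) (N ∷ Δ) (x ∷ xs) with TightCtx-⊎⁻ Γ Δ xs
... | ys , zs = ++⁻ˡ M x ∷ ys , ++⁻ʳ M x ∷ zs

Tight : Res n → Set
Tight (Γ , _) = TightCtx Γ

Tight-∙⁻ : ∀ {r : Res n} r₁ r₂ → r ≃ r₁ ∙ r₂ → Tight r → Tight r₁ × Tight r₂
Tight-∙⁻ r₁ r₂ (p , _) x = TightCtx-⊎⁻ _ _ (TightCtx-resp p x)

Tight-paid⁻ : ∀ {r : Res n} r₁ r₂ {c} → r ≃ (r₁ ∙ r₂) ∙ pure c → Tight r → Tight r₁ × Tight r₂
Tight-paid⁻ r₁ r₂ {c} p x = Tight-∙⁻ r₁ r₂ ≃-refl (proj₁ (Tight-∙⁻ (r₁ ∙ r₂) (pure c) p x))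

-- This rules out variables at arrow and multiset types, where `Outcome` admits no normal form.
tight-var : ∀ (i : Fin n) {σ} → TightCtx (i ∶[ σ ]) → IsTight σ
tight-var zero    ((x ∷ []) ∷ _) = x
tight-var (suc i) (_ ∷ xs)       = tight-var i xs

paid-size : ∀ {k d a} → k Costs.≈ d Costs.∙ unit-size → d Costs.≈ (0 , 0 , a) → k Costs.≈ (0 , 0 , suc a)
paid-size {a = a} p q = Costs.trans p (Costs.trans (Costs.∙-congʳ {x = unit-size} q) (refl , refl , +-comm a 1))

-- Induction on the derivation. Each premise visited has a tight context: `lam-p` and a persistent
-- `sub` bind a tight multiset. The premises of `lam-c` and `bang-c`, whose contexts may fail to be
-- tight, are not visited.
progress : ∀ {r : Res n} {t σ} → Tight r → r ⊩ t ∶ σ → Outcome r t σ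
progress x (var {i} (p , q)) with tight-var i (TightCtx-resp p x)
... | tt c = normal (ne (var i)) q
progress x (app-p {r₁} {r₂} d d′ y p) with progress (proj₁ (Tight-paid⁻ r₁ r₂ p x)) d
... | step {κ} {r′ = r′} s d₁ e = step (·ˡ-cong s) (app-p d₁ d′ y ≃-refl)
  (extractˡ (r′ ∙ r₂) _ (cost κ) p (extractˡ r′ r₂ (cost κ) ≃-refl e))
... | normal w k with progress (proj₂ (Tight-paid⁻ r₁ r₂ p x)) d′
...   | step {κ} {r′ = r′} s d₁ e = step (·ʳ-cong s) (app-p d d₁ y ≃-refl)
  (extractˡ (r₁ ∙ r′) _ (cost κ) p (extractʳ r₁ r′ (cost κ) ≃-refl e))
-- The type `𝕟` makes the function neutral, and `ā ≢ 𝕒` keeps abstractions out of argument position.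
...   | normal w′ k′ = normal (ne (neutral w · non-abstraction y w′))
  (paid-size (proj₂ p) (Costs.∙-cong k k′))
progress x (app-c {r₁} {r₂} d d′ y p) with progress (proj₁ (Tight-paid⁻ r₁ r₂ p x)) d
... | step {κ} {r′ = r′} s d₁ e = step (·ˡ-cong s) (app-c d₁ d′ y ≃-refl)
  (extractˡ (r′ ∙ r₂) _ (cost κ) p (extractˡ r′ r₂ (cost κ) ≃-refl e))
-- At an arrow type the only outcome besides a step is an abstraction inside a list context, so
-- there is a redex whatever the argument is.
... | lam L u = step (weak □ (dB L u _)) (dB-⊩ L d d′ y) p
progress x (lam-p {r₁} {M} d y p) with progress (y ∷ proj₁ (Tight-∙⁻ r₁ _ p x)) d
... | step {κ} {r′ = r′} s d₁ e with unbind r₁ r′ e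
...   | r″ , e₁ , e₂ = step (ƛ-cong s) (lam-p (⊩-resp e₂ d₁) y ≃-refl)
  (extractˡ r″ (pure unit-size) (cost κ) p e₁)
progress x (lam-p {r₁} {M} d y p) | normal w k =
  normal (nb (ƛ Normal⇒No-wcf w)) (paid-size (proj₂ p) k)
progress x (lam-c _) = lam □ _
progress x (bang-p (_ , q)) = normal (na (! _)) q
progress x (bang-c _ _) = bang □ _
progress x (der-p {r₁} d p) with progress (proj₁ (Tight-∙⁻ r₁ _ p x)) d
... | step {κ} {r′ = r′} s d₁ e = step (der-cong s) (der-p d₁ ≃-refl) (extractˡ r′ (pure unit-size) (cost κ) p e)
... | normal w k = normal (ne (der (neutral w)))
  (paid-size (proj₂ p) k)
progress x (der-c d) with progress x d
... | step s d₁ e = step (der-cong s) (der-c d₁) e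
... | bang L u with d!-⊩ L d
...   | _ , d₁ , e = step (weak □ (d! L u)) d₁ e
-- The argument comes first: if it is consumed, it steps or is a bang, and the body, where `M` may
-- not be tight, need not be examined.
progress x (sub {r₁} {r₂} d d′ y p) with progress (proj₂ (Tight-∙⁻ r₁ r₂ p x)) d′
... | step {κ} {r′ = r′} s d₁ e = step ([]ʳ-cong s) (sub d d₁ y ≃-refl) (extractʳ r₁ r′ (cost κ) p e)
progress x (sub {r₁} {r₂} d d′ consuming p) | bang L u with s!-⊩ L d d′
... | _ , d₁ , e = step (weak □ (s! _ L u)) d₁ (≃-trans p e)
progress x (sub {r₁} {r₂} d d′ (persistent y) p) | normal w k
  with progress (y ∷ proj₁ (Tight-∙⁻ r₁ r₂ p x)) d
... | step {κ} {r′ = r′} s d₁ e with unbind r₁ r′ e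
...   | r″ , e₁ , e₂ = step ([]ˡ-cong s) (sub (⊩-resp e₂ d₁) d′ (persistent y) ≃-refl)
  (extractˡ r″ r₂ (cost κ) p e₁)
progress x (sub d d′ (persistent y) p) | normal w k | normal w′ k′ =
  normal (normal-sub w′ (neutral w)) (Costs.trans (proj₂ p) (Costs.∙-cong k′ k))
-- A blocked substitution around a bang or an abstraction is absorbed into the list context, through
-- which the rules act.
progress x (sub d d′ (persistent y) p) | normal w k | bang L u = bang (L [ _ ]) u
progress x (sub d d′ (persistent y) p) | normal w k | lam L u = lam (L [ _ ]) u

-- Iteration to a normal form

prepend : ∀ {κ} {t u p : Term n} {b e s b′ e′ s′} → t →w⟨ κ ⟩ u →
          (b , e , s) Costs.≈ (b′ , e′ , s′) Costs.∙ cost κ → u ↠w⟨ b′ ⨟ e′ ⟩ p → t ↠w⟨ b ⨟ e ⟩ p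
prepend {κ = multiplicative} {b′ = b′} {e′} st (refl , refl , _) ss
  rewrite +-comm b′ 1 | +-identityʳ e′ = m-step st ss
prepend {κ = exponential} {b′ = b′} {e′} st (refl , refl , _) ss
  rewrite +-comm e′ 1 | +-identityʳ b′ = e-step st ss

steps-suc : ∀ κ {b e s} c → (b , e , s) Costs.≈ c Costs.∙ cost κ → b + e ≡ suc (proj₁ c + proj₁ (proj₂ c))
steps-suc multiplicative (b , e , _) (refl , refl , _) rewrite +-comm b 1 | +-identityʳ e = refl
steps-suc exponential    (b , e , _) (refl , refl , _) rewrite +-comm e 1 | +-identityʳ b = +-suc b e

size-unchanged : ∀ κ {s s′ : ℕ} → s ≡ s′ + proj₂ (proj₂ (cost κ)) → s′ ≡ s
size-unchanged multiplicative p = ≡.sym (≡.trans p (+-identityʳ _))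
size-unchanged exponential    p = ≡.sym (≡.trans p (+-identityʳ _))

normalise : ∀ k {Γ : Ctx n} {b e s t σ} → b + e ≡ k → (Γ , b , e , s) ⊩ t ∶ σ → TightCtx Γ → IsTight σ →
            ∃[ p ] (No-wcf p × (t ↠w⟨ b ⨟ e ⟩ p) × (∣ p ∣w ≡ s))
normalise k q d x (tt c) with progress x d
... | normal w (refl , refl , refl) = _ , Normal⇒No-wcf w , done , refl
... | step {κ} {r′ = Γ , c′} st d₁ (p , p′) with k | ≡.trans (≡.sym q) (steps-suc κ c′ p′)
-- By `steps-suc` a step makes `b + e` positive, so the case of `k` being zero cannot arise.
...   | suc k′ | q′ with normalise k′ (≡.sym (suc-injective q′)) d₁ (TightCtx-resp (Ctxs.trans p (Ctxs.identityʳ Γ)) x) (tt c)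
...     | t′ , w , ss , z = t′ , w , prepend st p′ ss , ≡.trans z (size-unchanged κ (proj₂ (proj₂ p′)))

theorem5p13 : ∀ {n : ℕ} {Γ : Ctx n} {b e s : ℕ} {t : Term n} {σ : Type}
    (Φ : Γ ⊢⟨ b ⨟ e ⨟ s ⟩ t ∶ σ) → TightDerivation Φ →
    ∃[ p ] (No-wcf p × (t ↠w⟨ b ⨟ e ⟩ p) × (∣ p ∣w ≡ s))
theorem5p13 Φ (x , y) = normalise _ refl (⊢⇒⊩ Φ) x y
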